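{- Let $T$ be a tree on $n$ vertices with maximum degree $\Delta$. Then $H(T)\ge H(B_{n,\Delta})$, with equality if and only if $T\cong B_{n,\Delta}$.
   Context: The Harary index of a connected graph $G$ is $H(G)=\sum_{\{x,y\}\subseteq V(G),\,x\ne y}\frac{1}{d(x,y)}$, $d$ the shortest-path distance. The broom $B_{n,\Delta}$ is the tree on $n$ vertices consisting of a star $S_{\Delta+1}$ and a path of length $n-\Delta-1$ attached at one pendent vertex of the star. -}

module Defs where

open import Data.Bool using (Bool; true; false; _∧_; _∨_; if_then_else_)
open import Data.Nat using (ℕ; zero; suc; _≡ᵇ_; _<ᵇ_; _≤ᵇ_; _⊔_)
import Data.Nat as ℕ
open import Data.Fin using (Fin; toℕ)
open import Data.List using (List; []; _∷_; _++_; map; foldr; length; allFin)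
open import Data.Nat.ListAction using (sum)
open import Data.Bool.ListAction using (any)
open import Data.List.Relation.Unary.Unique.Propositional using (Unique)
open import Data.Integer using (+_)
open import Data.Rational using (ℚ; 0ℚ; _+_; _/_)
open import Data.Product using (Σ; ∃; _×_; _,_)
open import Relation.Nullary using (¬_)
open import Relation.Binary.PropositionalEquality using (_≡_)
open import Function.Bundles using (_↔_; Inverse)

Graph : ℕ → Set
Graph n = Fin n → Fin n → Bool

module _ {n : ℕ} where

  Adj : Graph n → Fin n → Fin n → Set
  Adj G x y = G x y ≡ true

  record IsSimple (G : Graph n) : Set where
    field
      symmetric  : ∀ x y → G x y ≡ G y x
      irreflexive : ∀ x → G x x ≡ false

  data Walk (G : Graph n) : Fin n → Fin n → Set where
    here : ∀ x → Walk G x x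
    step : ∀ {x y z} → Adj G x y → Walk G y z → Walk G x z

  Connected : Graph n → Set
  Connected G = ∀ x y → Walk G x y

  data Chain (G : Graph n) : List (Fin n) → Set where
    single : ∀ x → Chain G (x ∷ [])
    cons   : ∀ {x y vs} → Adj G x y → Chain G (y ∷ vs) → Chain G (x ∷ y ∷ vs)

  HasCycle : Graph n → Set
  HasCycle G = Σ (Fin n) λ x → Σ (List (Fin n)) λ vs →
    (2 ℕ.≤ length vs) × Unique (x ∷ vs) × Chain G (x ∷ vs ++ x ∷ [])

  IsTree : Graph n → Set
  IsTree G = IsSimple G × Connected G × ¬ HasCycle G

  degree : Graph n → Fin n → ℕ
  degree G x = sum (map (λ y → if G x y then 1 else 0) (allFin n))

  maxDegree : Graph n → ℕ
  maxDegree G = foldr _⊔_ 0 (map (degree G) (allFin n))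

  reachB : Graph n → ℕ → Fin n → Fin n → Bool
  reachB G zero x y = toℕ x ≡ᵇ toℕ y
  reachB G (suc k) x y = any (λ z → G x z ∧ reachB G k z y) (allFin n)

  distFrom : Graph n → Fin n → Fin n → ℕ → ℕ → ℕ
  distFrom G x y k zero = k
  distFrom G x y k (suc fuel) = if reachB G k x y then k else distFrom G x y (suc k) fuel

  -- shortest-path distance (all distances in a connected graph on n vertices are < n)
  dist : Graph n → Fin n → Fin n → ℕ
  dist G x y = distFrom G x y 0 n

recip : ℕ → ℚ
recip zero = 0ℚ
recip (suc k) = + 1 / suc k

sumℚ : List ℚ → ℚ
sumℚ = foldr _+_ 0ℚ

harary : ∀ {n} → Graph n → ℚ
harary {n} G = sumℚ (map (λ x → sumℚ (map (λ y →
  if toℕ x <ᵇ toℕ y then recip (dist G x y) else 0ℚ) (allFin n))) (allFin n))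

-- Broom B_{n,Δ}: centre 0 joined to 1,…,Δ (star S_{Δ+1}), and the path
-- Δ — Δ+1 — … — n-1 (length n-Δ-1) attached at the pendent vertex Δ.
broomEdge : ℕ → ℕ → ℕ → Bool
broomEdge Δ i j = ((i ≡ᵇ 0) ∧ (1 ≤ᵇ j) ∧ (j ≤ᵇ Δ)) ∨ ((Δ ≤ᵇ i) ∧ (j ≡ᵇ suc i))

broom : (n Δ : ℕ) → Graph n
broom n Δ x y = broomEdge Δ (toℕ x) (toℕ y) ∨ broomEdge Δ (toℕ y) (toℕ x)

Isomorphic : ∀ {n} → Graph n → Graph n → Set
Isomorphic {n} G H = Σ (Fin n ↔ Fin n) λ σ →
  ∀ x y → G x y ≡ H (Inverse.to σ x) (Inverse.to σ y)

{-# OPTIONS --safe #-}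
module Submission where

-- Write Δ = D + 1 and list the vertices of T so that a vertex w of degree Δ comes first, then its
-- neighbours, and every later vertex is adjacent to an earlier one. H(T) is the sum over v of the
-- reciprocal distances from v to the m vertices listed before it. These distances leave no gap
-- (distance changes by at most 1 along an edge) and are at most m - D + 1, because the closed
-- neighbourhood of w spans at most three levels and each further vertex adds at most one. Among
-- such multisets the sum of reciprocals is least for 1, …, m - D together with D copies of
-- m - D + 1, which are the distances met when the broom is listed in its natural order (while
-- m ≤ D, the role of D is played by m - 1). If H(T) = H(B), the last listed vertex v attains the
-- minimum, so all levels around v except the farthest are singletons; as T has no triangle, its
-- edges are then the pairs on consecutive levels, and the same holds in the broom.

open import Defs
open import Data.Bool as Bool using (true; false; T; _∧_; _∨_; if_then_else_)
open import Data.Bool.Properties using (T-≡; T-∧; T-∨; ⇔→≡; ∨-comm)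
open import Data.Fin as Fin using (Fin; toℕ)
import Data.Fin.Permutation as Perm
import Data.Fin.Properties as Fin
import Data.Integer as ℤ
open import Data.List using (List; []; _∷_; [_]; _++_; _∷ʳ_; map; foldr; filter; length; lookup; replicate; tabulate; allFin; upTo; applyUpTo; applyDownFrom)
import Data.List.Membership.DecPropositional as DecMembership
open import Data.List.Membership.Propositional using (_∈_; _∉_; lose; find)
open import Data.List.Membership.Propositional.Properties using (∈-allFin; ∈-map⁺; ∈-map⁻; ∈-lookup; ∈-++⁺ʳ; ∈-++⁻; ∈-filter⁻; ∈-filter⁺; ∈-length; ∈-∃++; foldr-selective)
open import Data.List.Membership.Propositional.Properties.WithK using (unique∧set⇒bag)
open import Data.List.Properties using (++-identityʳ; length-map; length-++; length-tabulate; lookup-tabulate; map-∘; map-++; map-applyUpTo; map-tabulate; upTo-∷ʳ; applyDownFrom-∷ʳ)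
open import Data.List.Relation.Binary.BagAndSetEquality using (∼bag⇒↭)
open import Data.List.Relation.Binary.Permutation.Homogeneous using (onIndices)
open import Data.List.Relation.Binary.Permutation.Propositional using (_↭_; refl; prep; swap; trans; ↭-sym; ↭-trans; ↭-reflexive; ↭⇒↭ₛ; module PermutationReasoning)
open import Data.List.Relation.Binary.Permutation.Propositional.Properties using (shift; map⁺; ++⁺ʳ; ++-comm; ∷↭∷ʳ; ∈-resp-↭; All-resp-↭; ↭-length)
open import Data.List.Relation.Binary.Permutation.Setoid.Properties using (onIndices-lookup)
open import Data.List.Relation.Unary.All as All using (All; []; _∷_)
import Data.List.Relation.Unary.All.Properties as All
open import Data.List.Relation.Unary.AllPairs as AllPairs using (AllPairs; []; _∷_)
import Data.List.Relation.Unary.AllPairs.Properties as AllPairs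
open import Data.List.Relation.Unary.Any using (here; there)
open import Data.List.Relation.Unary.Any.Properties using (any⁺; any⁻)
open import Data.List.Relation.Unary.Unique.Propositional using (Unique)
open import Data.List.Relation.Unary.Unique.Propositional.Properties using (allFin⁺; Unique[x∷xs]⇒x∉xs) renaming (map⁺ to Unique-map⁺; filter⁺ to Unique-filter⁺)
open import Data.Nat as ℕ using (ℕ; zero; suc; z≤n; s≤s; _∸_; _⊓_; _⊔_; _<ᵇ_)
open import Data.Nat.ListAction using (sum)
import Data.Nat.Properties as ℕ
open import Data.Product using (Σ; ∃; _×_; _,_; proj₁; proj₂)
open import Data.Rational using (ℚ; 0ℚ; _+_; _<_; _≤_)
import Data.Rational.Properties as ℚ
import Data.Rational.Unnormalised as ℚᵘ
import Data.Rational.Unnormalised.Properties as ℚᵘ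
open import Data.Sum as Sum using (_⊎_; inj₁; inj₂)
open import Function using (_∘_; id)
open import Function.Bundles using (_⇔_; mk⇔; _↔_; Inverse; Equivalence)
open import Relation.Binary.Definitions using (tri<; tri≈; tri>)
open import Relation.Binary.PropositionalEquality as ≡ using (_≡_; _≢_; refl; sym; cong; cong₂; subst; module ≡-Reasoning)
open import Relation.Nullary using (¬_; Dec; yes; no; contradiction)
open import Relation.Nullary.Decidable using (¬?; decidable-stable)

-- Reciprocals and tight inequalities in the rationals.

recip-antimono-< : ∀ {a b} → 1 ℕ.≤ a → a ℕ.< b → recip b < recip a
recip-antimono-< {suc a} {suc b} _ a<b = ℚ.toℚᵘ-cancel-<
  (ℚᵘ.<-respʳ-≃ (ℚᵘ.≃-sym (ℚ.toℚᵘ-fromℚᵘ (ℚᵘ.mkℚᵘ ℤ.1ℤ a)))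
  (ℚᵘ.<-respˡ-≃ (ℚᵘ.≃-sym (ℚ.toℚᵘ-fromℚᵘ (ℚᵘ.mkℚᵘ ℤ.1ℤ b)))
  (ℚᵘ.*<* (ℤ.+<+ (≡.subst₂ ℕ._<_ (sym (ℕ.+-identityʳ (suc a))) (sym (ℕ.+-identityʳ (suc b))) a<b)))))

recip-antimono-≤ : ∀ {a b} → 1 ℕ.≤ a → a ℕ.≤ b → recip b ≤ recip a
recip-antimono-≤ 1≤a a≤b with ℕ.m≤n⇒m<n∨m≡n a≤b
... | inj₁ a<b  = ℚ.<⇒≤ (recip-antimono-< 1≤a a<b)
... | inj₂ refl = ℚ.≤-refl

recip-injective : ∀ {a b} → 1 ℕ.≤ a → 1 ℕ.≤ b → recip a ≡ recip b → a ≡ b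
recip-injective {a} {b} 1≤a 1≤b eq with ℕ.<-cmp a b
... | tri< a<b _ _ = contradiction (recip-antimono-< 1≤a a<b) (ℚ.<-irrefl (sym eq))
... | tri≈ _ a≡b _ = a≡b
... | tri> _ _ b<a = contradiction (recip-antimono-< 1≤b b<a) (ℚ.<-irrefl eq)

-- A strict inequality in either summand would make the sum strict. Through this, equality of totals
-- is passed down to single summands.
+-≤-tight : ∀ {p q r s} → p ≤ q → r ≤ s → q + s ≡ p + r → q ≡ p × s ≡ r
+-≤-tight {p} {q} {r} {s} p≤q r≤s eq with ℚ.<-cmp p q | ℚ.<-cmp r s
... | tri< p<q _ _ | _            = contradiction (ℚ.+-mono-<-≤ p<q r≤s) (ℚ.<-irrefl (sym eq))
... | tri> _ _ q<p | _            = contradiction (ℚ.<-≤-trans q<p p≤q) (ℚ.<-irrefl refl)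
... | tri≈ _ p≡q _ | tri< r<s _ _ = contradiction (ℚ.+-mono-≤-< p≤q r<s) (ℚ.<-irrefl (sym eq))
... | tri≈ _ p≡q _ | tri≈ _ r≡s _ = sym p≡q , sym r≡s
... | tri≈ _ p≡q _ | tri> _ _ s<r = contradiction (ℚ.<-≤-trans s<r r≤s) (ℚ.<-irrefl refl)

x+[y+z]≡y+[x+z] : ∀ x y z → x + (y + z) ≡ y + (x + z)
x+[y+z]≡y+[x+z] x y z =
  ≡.trans (sym (ℚ.+-assoc x y z)) (≡.trans (cong (_+ z) (ℚ.+-comm x y)) (ℚ.+-assoc y x z))

sumℚ-↭ : ∀ {ps qs} → ps ↭ qs → sumℚ ps ≡ sumℚ qs
sumℚ-↭ refl          = refl
sumℚ-↭ (prep p ↭)    = cong (_+_ p) (sumℚ-↭ ↭)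
sumℚ-↭ (swap {xs = ps} p q ↭)  = ≡.trans (x+[y+z]≡y+[x+z] p q (sumℚ ps)) (cong (λ s → q + (p + s)) (sumℚ-↭ ↭))
sumℚ-↭ (trans ↭₁ ↭₂) = ≡.trans (sumℚ-↭ ↭₁) (sumℚ-↭ ↭₂)

-- Sums over lists and over unordered pairs.

module _ {A : Set} where

  Σ[_]_ : List A → (A → ℚ) → ℚ
  Σ[ xs ] f = sumℚ (map f xs)

  Σ-cong : ∀ {f g} {xs : List A} → (∀ {x} → x ∈ xs → f x ≡ g x) → Σ[ xs ] f ≡ Σ[ xs ] g
  Σ-cong {xs = []}     eq = refl
  Σ-cong {xs = x ∷ xs} eq = cong₂ _+_ (eq (here refl)) (Σ-cong (eq ∘ there))

  Σ-mono-≤ : ∀ {f g} {xs : List A} → (∀ {x} → x ∈ xs → f x ≤ g x) → Σ[ xs ] f ≤ Σ[ xs ] g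
  Σ-mono-≤ {xs = []}     le = ℚ.≤-refl
  Σ-mono-≤ {xs = x ∷ xs} le = ℚ.+-mono-≤ (le (here refl)) (Σ-mono-≤ (le ∘ there))

  Σ-↭ : ∀ f {xs ys : List A} → xs ↭ ys → Σ[ xs ] f ≡ Σ[ ys ] f
  Σ-↭ f = sumℚ-↭ ∘ map⁺ f

  pairSum : (A → A → ℚ) → List A → ℚ
  pairSum s []       = 0ℚ
  pairSum s (x ∷ xs) = Σ[ xs ] (s x) + pairSum s xs

  pairSum-↭ : ∀ {s} → (∀ x y → s x y ≡ s y x) → ∀ {xs ys} → xs ↭ ys → pairSum s xs ≡ pairSum s ys
  pairSum-↭     s-sym refl            = refl
  pairSum-↭ {s} s-sym (prep x ↭)      = cong₂ _+_ (Σ-↭ (s x) ↭) (pairSum-↭ s-sym ↭)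
  pairSum-↭     s-sym (trans ↭₁ ↭₂)   = ≡.trans (pairSum-↭ s-sym ↭₁) (pairSum-↭ s-sym ↭₂)
  pairSum-↭ {s} s-sym (swap {xs} {ys} x y ↭) = begin
    (s x y + Σ[ xs ] (s x)) + (Σ[ xs ] (s y) + pairSum s xs)  ≡⟨ ℚ.+-assoc (s x y) _ _ ⟩
    s x y + (Σ[ xs ] (s x) + (Σ[ xs ] (s y) + pairSum s xs))
      ≡⟨ cong₂ _+_ (s-sym x y) (x+[y+z]≡y+[x+z] (Σ[ xs ] (s x)) (Σ[ xs ] (s y)) (pairSum s xs)) ⟩
    s y x + (Σ[ xs ] (s y) + (Σ[ xs ] (s x) + pairSum s xs))  ≡⟨ ℚ.+-assoc (s y x) _ _ ⟨
    (s y x + Σ[ xs ] (s y)) + (Σ[ xs ] (s x) + pairSum s xs)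
      ≡⟨ cong₂ (λ p q → (s y x + p) + q) (Σ-↭ (s y) ↭) (cong₂ _+_ (Σ-↭ (s x) ↭) (pairSum-↭ s-sym ↭)) ⟩
    (s y x + Σ[ ys ] (s y)) + (Σ[ ys ] (s x) + pairSum s ys)  ∎
    where open ≡-Reasoning

  pairSum-mono-≤ : ∀ {R : A → A → Set} {s t} → (∀ {x y} → R x y → s x y ≤ t x y) →
                   ∀ {xs} → AllPairs R xs → pairSum s xs ≤ pairSum t xs
  pairSum-mono-≤ le []           = ℚ.≤-refl
  pairSum-mono-≤ le (Rx ∷ Rxs) = ℚ.+-mono-≤ (Σ-mono-≤ (le ∘ All.lookup Rx)) (pairSum-mono-≤ le Rxs)

  pairSum-∷ʳ : ∀ s xs (y : A) → pairSum s (xs ∷ʳ y) ≡ Σ[ xs ] (λ x → s x y) + pairSum s xs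
  pairSum-∷ʳ s []       y = refl
  pairSum-∷ʳ s (x ∷ xs) y = begin
    Σ[ xs ∷ʳ y ] (s x) + pairSum s (xs ∷ʳ y)
      ≡⟨ cong₂ _+_ (Σ-↭ (s x) (shift y xs [])) (pairSum-∷ʳ s xs y) ⟩
    (s x y + Σ[ xs ++ [] ] (s x)) + (Σ[ xs ] (λ x → s x y) + pairSum s xs)
      ≡⟨ cong (λ zs → (s x y + Σ[ zs ] (s x)) + (Σ[ xs ] (λ x → s x y) + pairSum s xs)) (++-identityʳ xs) ⟩
    (s x y + Σ[ xs ] (s x)) + (Σ[ xs ] (λ x → s x y) + pairSum s xs)
      ≡⟨ ℚ.+-assoc (s x y) _ _ ⟩
    s x y + (Σ[ xs ] (s x) + (Σ[ xs ] (λ x → s x y) + pairSum s xs))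
      ≡⟨ cong (s x y +_) (x+[y+z]≡y+[x+z] (Σ[ xs ] (s x)) (Σ[ xs ] (λ x → s x y)) (pairSum s xs)) ⟩
    s x y + (Σ[ xs ] (λ x → s x y) + (Σ[ xs ] (s x) + pairSum s xs))
      ≡⟨ ℚ.+-assoc (s x y) _ _ ⟨
    (s x y + Σ[ xs ] (λ x → s x y)) + (Σ[ xs ] (s x) + pairSum s xs)
      ∎
    where open ≡-Reasoning

  -- When `ι` increases along the list, the test holds exactly if `y` comes after `x`: the row of
  -- the head is the sum over the tail, and the column of the head vanishes.
  Σ-if-pairSum : ∀ (ι : A → ℕ) s {xs} → AllPairs (λ x y → ι x ℕ.< ι y) xs →
    Σ[ xs ] (λ x → Σ[ xs ] (λ y → if ι x <ᵇ ι y then s x y else 0ℚ)) ≡ pairSum s xs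
  Σ-if-pairSum ι s {[]}     []           = refl
  Σ-if-pairSum ι s {x ∷ xs} (x< ∷ xs<) = cong₂ _+_ first rest
    where
    open ≡-Reasoning
    s′ : A → A → ℚ
    s′ x y = if ι x <ᵇ ι y then s x y else 0ℚ

    s′-< : ∀ {x y} → ι x ℕ.< ι y → s′ x y ≡ s x y
    s′-< {x} {y} lt with ι x <ᵇ ι y | ℕ.<⇒<ᵇ lt
    ... | true | _ = refl

    s′-≥ : ∀ {x y} → ι y ℕ.≤ ι x → s′ x y ≡ 0ℚ
    s′-≥ {x} {y} ge with ι x <ᵇ ι y | ℕ.<ᵇ⇒< (ι x) (ι y)
    ... | true  | lt = contradiction (lt _) (ℕ.≤⇒≯ ge)
    ... | false | _  = refl

    first : s′ x x + Σ[ xs ] (s′ x) ≡ Σ[ xs ] (s x)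
    first = ≡.trans (cong₂ _+_ (s′-≥ {x} ℕ.≤-refl) (Σ-cong (s′-< ∘ All.lookup x<))) (ℚ.+-identityˡ _)

    rest : Σ[ xs ] (λ z → s′ z x + Σ[ xs ] (s′ z)) ≡ pairSum s xs
    rest = begin
      Σ[ xs ] (λ z → s′ z x + Σ[ xs ] (s′ z))
        ≡⟨ Σ-cong (λ {z} z∈ → ≡.trans (cong (_+ Σ[ xs ] (s′ z)) (s′-≥ (ℕ.<⇒≤ (All.lookup x< z∈)))) (ℚ.+-identityˡ _)) ⟩
      Σ[ xs ] (λ z → Σ[ xs ] (s′ z))
        ≡⟨ Σ-if-pairSum ι s xs< ⟩
      pairSum s xs
        ∎

pairSum-map : ∀ {A B : Set} (f : A → B) s xs → pairSum s (map f xs) ≡ pairSum (λ x y → s (f x) (f y)) xs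
pairSum-map f s []       = refl
pairSum-map f s (x ∷ xs) = cong₂ _+_ (cong sumℚ (sym (map-∘ xs))) (pairSum-map f s xs)

-- The least sum of reciprocals of a gap-free multiset.

-- The extremal multiset: `c` consecutive levels starting at `t`, one entry each, and all `r`
-- remaining entries together on the next level.
profile : ℕ → ℕ → ℕ → List ℕ
profile t zero    r = replicate r t
profile t (suc c) r = t ∷ profile (suc t) c r

reciprocals : List ℕ → ℚ
reciprocals ds = Σ[ ds ] recip

-- Entries below `t` impose nothing, so surplus small entries may stay in the list while `t` grows.
GapFree : ℕ → List ℕ → Set
GapFree t ds = ∀ {d s} → d ∈ ds → t ℕ.≤ s → s ℕ.≤ d → s ∈ ds

-- Greedy comparison: match level t with an entry t of ds if there is one; if not, gap-freeness
-- makes every entry smaller than t, and any entry will do.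
reciprocals-profile : ∀ t c r ds → 1 ℕ.≤ t → length ds ≡ c ℕ.+ r → GapFree t ds →
  All (1 ℕ.≤_) ds → All (ℕ._≤ c ℕ.+ t) ds →
  reciprocals (profile t c r) ≤ reciprocals ds ×
  (reciprocals ds ≡ reciprocals (profile t c r) → ds ↭ profile t c r)
reciprocals-profile t zero zero [] 1≤t len gf lo hi = ℚ.≤-refl , λ _ → refl
reciprocals-profile t zero (suc r) (d ∷ ds) 1≤t len gf (1≤d ∷ lo) (d≤t ∷ hi) =
  ℚ.+-mono-≤ first (proj₁ ih) , tight
  where
  first = recip-antimono-≤ 1≤d d≤t
  gf′ : GapFree t ds
  gf′ e∈ t≤s s≤e = subst (_∈ ds) (ℕ.≤-antisym (ℕ.≤-trans (All.lookup hi e∈) t≤s) s≤e) e∈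
  ih = reciprocals-profile t zero r ds 1≤t (ℕ.suc-injective len) gf′ lo hi
  tight : recip d + reciprocals ds ≡ recip t + reciprocals (replicate r t) → d ∷ ds ↭ t ∷ replicate r t
  tight eq with +-≤-tight first (proj₁ ih) eq
  ... | eq₁ , eq₂ with recip-injective 1≤d 1≤t eq₁
  ... | refl = prep d (proj₂ ih eq₂)
reciprocals-profile t (suc c) r ds 1≤t len gf lo hi = by (t ∈? ds)
  where
  open DecMembership ℕ._≟_ using (_∈?_)
  Goal = reciprocals (profile t (suc c) r) ≤ reciprocals ds ×
         (reciprocals ds ≡ reciprocals (profile t (suc c) r) → ds ↭ profile t (suc c) r)

  -- Common to both cases: an entry `d ≤ t` is paired with `t`, and the rest is compared from
  -- `suc t` on. The upper bound survives because `c + suc t = suc c + t`.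
  remove : ∀ {d es} → ds ↭ d ∷ es → d ℕ.≤ t → GapFree (suc t) es → Goal
  remove {d} {es} ds↭ d≤t gf′
    with All-resp-↭ ds↭ lo | All-resp-↭ ds↭ hi
  ... | 1≤d ∷ lo′ | _ ∷ hi′ = subst (_ ≤_) (sym split) (ℚ.+-mono-≤ first (proj₁ ih)) , tight ∘ ≡.trans (sym split)
    where
    split : reciprocals ds ≡ recip d + reciprocals es
    split = Σ-↭ recip ds↭
    first = recip-antimono-≤ 1≤d d≤t
    ih = reciprocals-profile (suc t) c r es (s≤s z≤n)
           (ℕ.suc-injective (≡.trans (sym (↭-length ds↭)) len)) gf′ lo′
           (All.map (λ {e} → subst (e ℕ.≤_) (sym (ℕ.+-suc c t))) hi′)
    tight : recip d + reciprocals es ≡ recip t + reciprocals (profile (suc t) c r) → ds ↭ t ∷ profile (suc t) c r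
    tight eq with +-≤-tight first (proj₁ ih) eq
    ... | eq₁ , eq₂ with recip-injective 1≤d 1≤t eq₁
    ... | refl = ↭-trans ds↭ (prep d (proj₂ ih eq₂))

  below : t ∉ ds → ∀ {d} → d ∈ ds → d ℕ.< t
  below t∉ds {d} d∈ with d ℕ.<? t
  ... | yes d<t = d<t
  ... | no  d≮t = contradiction (gf d∈ ℕ.≤-refl (ℕ.≮⇒≥ d≮t)) t∉ds

  nonempty : ∀ ds → length ds ≡ suc c ℕ.+ r → ∃ λ d → ∃ λ es → ds ≡ d ∷ es
  nonempty (d ∷ es) _ = d , es , refl

  by : Dec (t ∈ ds) → Goal
  by (yes t∈ds) with ∈-∃++ t∈ds
  ... | xs , ys , refl = remove ds↭ ℕ.≤-refl gf′
    where
    ds↭ = shift t xs ys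
    gf′ : GapFree (suc t) (xs ++ ys)
    gf′ e∈ t<s s≤e with ∈-resp-↭ ds↭ (gf (∈-resp-↭ (↭-sym ds↭) (there e∈)) (ℕ.<⇒≤ t<s) s≤e)
    ... | here s≡t = contradiction (sym s≡t) (ℕ.<⇒≢ t<s)
    ... | there s∈ = s∈
  by (no t∉ds) with nonempty ds len
  ... | d , es , eq = remove (↭-reflexive eq) (ℕ.<⇒≤ (below t∉ds (in-ds (here refl))))
      -- Every entry is below `t`, so gap-freeness from `suc t` is vacuous.
      (λ e∈ t<s s≤e → contradiction (ℕ.≤-<-trans s≤e (below t∉ds (in-ds (there e∈)))) (ℕ.<⇒≯ t<s))
    where
    in-ds : ∀ {e} → e ∈ d ∷ es → e ∈ ds
    in-ds = subst (_ ∈_) (sym eq)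

-- Paths of given length and the computed distance.

-- Unlike `Walk`, indexed by the length: the propositional form of `reachB`.
data Path {n : ℕ} (G : Graph n) : ℕ → Fin n → Fin n → Set where
  stop : ∀ {x} → Path G 0 x x
  step : ∀ {k x y z} → Adj G x y → Path G k y z → Path G (suc k) x z

module _ {n : ℕ} {G : Graph n} where

  reachB⇒Path : ∀ k {x y} → T (reachB G k x y) → Path G k x y
  reachB⇒Path zero {x} {y} r with refl ← Fin.toℕ-injective (ℕ.≡ᵇ⇒≡ (toℕ x) (toℕ y) r) = stop
  reachB⇒Path (suc k) {x} {y} r with find (any⁻ (λ z → G x z ∧ reachB G k z y) (allFin n) r)
  ... | z , _ , both with Equivalence.to (T-∧ {G x z}) both
  ... | xz , zy = step (Equivalence.to T-≡ xz) (reachB⇒Path k zy)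

  Path⇒reachB : ∀ {k x y} → Path G k x y → T (reachB G k x y)
  Path⇒reachB (stop {x}) = ℕ.≡⇒≡ᵇ (toℕ x) (toℕ x) refl
  Path⇒reachB (step {k} {x} {z} {y} xz p) = any⁺ (λ z → G x z ∧ reachB G k z y)
    (lose (∈-allFin z) (Equivalence.from (T-∧ {G x z}) (Equivalence.from T-≡ xz , Path⇒reachB p)))

  _∷ᵖ_ : ∀ {k x y z} → Path G k x y → Adj G y z → Path G (suc k) x z
  stop     ∷ᵖ yz = step yz stop
  step a p ∷ᵖ yz = step a (p ∷ᵖ yz)

  unsnoc : ∀ {k x z} → Path G (suc k) x z → ∃ λ y → Path G k x y × Adj G y z
  unsnoc (step a stop) = _ , stop , a
  unsnoc (step a p@(step _ _)) with unsnoc p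
  ... | y , q , b = y , step a q , b

  distFrom-≤-fuel : ∀ x y k fuel → distFrom G x y k fuel ℕ.≤ k ℕ.+ fuel
  distFrom-≤-fuel x y k zero = ℕ.m≤m+n k 0
  distFrom-≤-fuel x y k (suc fuel) with reachB G k x y
  ... | true  = ℕ.m≤m+n k (suc fuel)
  ... | false = subst (distFrom G x y (suc k) fuel ℕ.≤_) (sym (ℕ.+-suc k fuel)) (distFrom-≤-fuel x y (suc k) fuel)

  distFrom-≤ : ∀ {x y j} → Path G j x y → ∀ k fuel → k ℕ.≤ j → distFrom G x y k fuel ℕ.≤ j
  distFrom-≤ p k zero k≤j = k≤j
  distFrom-≤ {x} {y} {j} p k (suc fuel) k≤j with reachB G k x y in eq
  ... | true  = k≤j
  ... | false = distFrom-≤ p (suc k) fuel (ℕ.≤∧≢⇒< k≤j λ { refl → subst T eq (Path⇒reachB p) })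

  -- A search that runs out of fuel returns `k + fuel`, for `dist` the default value `n`. Later
  -- facts about `dist` split on this alternative.
  distFrom-Path : ∀ x y k fuel → distFrom G x y k fuel ≡ k ℕ.+ fuel ⊎ Path G (distFrom G x y k fuel) x y
  distFrom-Path x y k zero = inj₁ (sym (ℕ.+-identityʳ k))
  distFrom-Path x y k (suc fuel) with reachB G k x y in eq
  ... | true  = inj₂ (reachB⇒Path k (subst T (sym eq) _))
  ... | false with distFrom-Path x y (suc k) fuel
  ...   | inj₁ eq′ = inj₁ (≡.trans eq′ (sym (ℕ.+-suc k fuel)))
  ...   | inj₂ p   = inj₂ p

  dist≤n : ∀ x y → dist G x y ℕ.≤ n
  dist≤n x y = distFrom-≤-fuel x y 0 n

  dist-≤ : ∀ {k x y} → Path G k x y → dist G x y ℕ.≤ k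
  dist-≤ p = distFrom-≤ p 0 n z≤n

  dist-Path : ∀ x y → dist G x y ≡ n ⊎ Path G (dist G x y) x y
  dist-Path x y = distFrom-Path x y 0 n

  dist-refl : ∀ x → dist G x x ≡ 0
  dist-refl x = ℕ.n≤0⇒n≡0 (dist-≤ stop)

  0<dist : ∀ {x y} → x ≢ y → 0 ℕ.< dist G x y
  0<dist {x} {y} x≢y with dist G x y | dist-Path x y
  ... | suc d | _         = s≤s z≤n
  ... | zero  | inj₂ stop = contradiction refl x≢y
  ... | zero  | inj₁ refl with () ← x

  -- A shortest path to `x` extends along the edge; if `dist G v x` is the default `n`, the general
  -- bound by `n` suffices.
  dist-step : ∀ v {x y} → Adj G x y → dist G v y ℕ.≤ suc (dist G v x)
  dist-step v {x} {y} xy with dist-Path v x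
  ... | inj₁ eq = ℕ.≤-trans (dist≤n v y) (subst (n ℕ.≤_) (cong suc (sym eq)) (ℕ.n≤1+n n))
  ... | inj₂ p  = dist-≤ (p ∷ᵖ xy)

  -- `x` is the last but one vertex of a shortest path to `y`; the bound `suc k < n` rules out the
  -- default value.
  dist-pred : ∀ {v y k} → dist G v y ≡ suc k → suc k ℕ.< n → ∃ λ x → dist G v x ≡ k × Adj G x y
  dist-pred {v} {y} {k} eq k<n with dist-Path v y
  ... | inj₁ eq′ = contradiction (≡.trans (sym eq) eq′) (ℕ.<⇒≢ k<n)
  ... | inj₂ p with unsnoc (subst (λ d → Path G d v y) eq p)
  ...   | x , q , xy = x , ℕ.≤-antisym (dist-≤ q) (ℕ.s≤s⁻¹ (subst (ℕ._≤ _) eq (dist-step v xy))) , xy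

  -- Along a path to `y` the function `φ` has to fall to 0 by steps of at most 1; `φ x ≤ n` covers
  -- the default value. A guessed `φ` thus bounds distances from below without computing them.
  dist-≥ : ∀ (φ : Fin n → ℕ) → (∀ {x y} → Adj G x y → φ x ℕ.≤ suc (φ y)) →
           ∀ {x y} → φ y ≡ 0 → φ x ℕ.≤ n → φ x ℕ.≤ dist G x y
  dist-≥ φ lip {x} {y} φy≡0 φx≤n with dist-Path x y
  ... | inj₁ eq = subst (φ x ℕ.≤_) (sym eq) φx≤n
  ... | inj₂ p  = along p φy≡0
    where
    along : ∀ {k x y} → Path G k x y → φ y ≡ 0 → φ x ℕ.≤ k
    along stop       eq = ℕ.≤-reflexive eq
    along (step a p) eq = ℕ.≤-trans (lip a) (s≤s (along p eq))

-- Symmetry of the distance and invariance under isomorphism.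

module _ {n : ℕ} {G H : Graph n} where

  dist-mono : ∀ {x y x′ y′} → (∀ {k} → Path G k x y → Path H k x′ y′) → dist H x′ y′ ℕ.≤ dist G x y
  dist-mono {x} {y} {x′} {y′} f with dist-Path {G = G} x y
  ... | inj₁ eq = subst (dist H x′ y′ ℕ.≤_) (sym eq) (dist≤n x′ y′)
  ... | inj₂ p  = dist-≤ (f p)

  Path-map : (f : Fin n → Fin n) → (∀ {x y} → Adj G x y → Adj H (f x) (f y)) →
             ∀ {k x y} → Path G k x y → Path H k (f x) (f y)
  Path-map f f-adj stop       = stop
  Path-map f f-adj (step a p) = step (f-adj a) (Path-map f f-adj p)

dist-iso : ∀ {n} {G H : Graph n} (iso : Isomorphic G H) → let f = Inverse.to (proj₁ iso) in
           ∀ x y → dist H (f x) (f y) ≡ dist G x y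
dist-iso {n} {G} {H} (σ , eq) x y = ℕ.≤-antisym
  (dist-mono (Path-map f (λ {x} {y} → ≡.trans (sym (eq x y)))))
  (dist-mono λ {k} p → ≡.subst₂ (Path G k) (Perm.inverseˡ σ) (Perm.inverseˡ σ) (Path-map g g-adj p))
  where
  f = Inverse.to σ
  g = Inverse.from σ
  g-adj : ∀ {x y} → Adj H x y → Adj G (g x) (g y)
  g-adj {x} {y} a = ≡.trans (eq (g x) (g y)) (≡.trans (cong₂ H (Perm.inverseʳ σ) (Perm.inverseʳ σ)) a)

dist-sym : ∀ {n} {G : Graph n} → IsSimple G → ∀ x y → dist G x y ≡ dist G y x
dist-sym {n} {G} simple x y = ℕ.≤-antisym (dist-mono flip) (dist-mono flip)
  where
  flip : ∀ {k x y} → Path G k x y → Path G k y x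
  flip stop                   = stop
  flip (step {x = x} {y} a p) = flip p ∷ᵖ ≡.trans (IsSimple.symmetric simple y x) a

dist-lipschitz : ∀ {n} {G : Graph n} → IsSimple G → ∀ v {x y} → Adj G x y →
                 dist G v x ℕ.≤ suc (dist G v y) × dist G v y ℕ.≤ suc (dist G v x)
dist-lipschitz simple v {x} {y} xy = dist-step v (≡.trans (IsSimple.symmetric simple y x) xy) , dist-step v xy

-- The Harary index as a sum over pairs of a list.

recipDist : ∀ {n} → Graph n → Fin n → Fin n → ℚ
recipDist G x y = recip (dist G x y)

allFin-< : ∀ n → AllPairs (λ (x y : Fin n) → toℕ x ℕ.< toℕ y) (allFin n)
allFin-< n = AllPairs.tabulate⁺-< id

harary≡pairSum : ∀ {n} (G : Graph n) → harary G ≡ pairSum (recipDist G) (allFin n)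
harary≡pairSum {n} G = Σ-if-pairSum toℕ (recipDist G) (allFin-< n)

unique∧full⇒↭ : ∀ {n} {L : List (Fin n)} → Unique L → (∀ x → x ∈ L) → L ↭ allFin n
unique∧full⇒↭ {n} uniq full =
  ∼bag⇒↭ (unique∧set⇒bag uniq (allFin⁺ n) (mk⇔ (λ _ → ∈-allFin _) (λ _ → full _)))

-- An isomorphism need not respect the index order in `harary`. As a `pairSum` of a symmetric
-- function the index depends on the list only up to permutation.
harary-iso : ∀ {n} {G H : Graph n} → IsSimple H → Isomorphic G H → harary G ≡ harary H
harary-iso {n} {G} {H} simple iso@(σ , _) = begin
  harary G                                                ≡⟨ harary≡pairSum G ⟩
  pairSum (recipDist G) (allFin n)
    ≡⟨ pairSum-cong (λ x y → cong recip (sym (dist-iso iso x y))) (allFin n) ⟩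
  pairSum (λ x y → recipDist H (f x) (f y)) (allFin n)    ≡⟨ pairSum-map f (recipDist H) (allFin n) ⟨
  pairSum (recipDist H) (map f (allFin n))                ≡⟨ pairSum-↭ (λ x y → cong recip (dist-sym simple x y)) σ↭ ⟩
  pairSum (recipDist H) (allFin n)                        ≡⟨ harary≡pairSum H ⟨
  harary H                                                ∎
  where
  open ≡-Reasoning
  f = Inverse.to σ
  pairSum-cong : ∀ {A : Set} {s t : A → A → ℚ} → (∀ x y → s x y ≡ t x y) → ∀ xs → pairSum s xs ≡ pairSum t xs
  pairSum-cong eq []       = refl
  pairSum-cong eq (x ∷ xs) = cong₂ _+_ (Σ-cong {xs = xs} λ {y} _ → eq x y) (pairSum-cong eq xs)
  σ↭ : map f (allFin n) ↭ allFin n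
  σ↭ = unique∧full⇒↭
    (Unique-map⁺ (λ eq → ≡.trans (sym (Perm.inverseˡ σ)) (≡.trans (cong (Inverse.from σ) eq) (Perm.inverseˡ σ))) (allFin⁺ n))
    (λ x → subst (_∈ map f (allFin n)) (Perm.inverseʳ σ) (∈-map⁺ f (∈-allFin (Inverse.from σ x))))

-- Turns an equality of multisets of levels into a bijection of vertices that preserves levels.
tabulate-↭⇒permutation : ∀ {A : Set} {n} (f g : Fin n → A) → tabulate f ↭ tabulate g →
                         Σ (Fin n ↔ Fin n) λ σ → ∀ i → g (Inverse.to σ i) ≡ f i
tabulate-↭⇒permutation {A} {n} f g f↭g = (cf Perm.∘ₚ π) Perm.∘ₚ Perm.flip cg , λ i → begin
  g (Perm.flip cg Perm.⟨$⟩ʳ (π Perm.⟨$⟩ʳ (cf Perm.⟨$⟩ʳ i)))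
    ≡⟨ ≡.trans (sym (lookup-tabulate g _)) (cong (lookup (tabulate g)) (Perm.inverseʳ cg)) ⟩
  lookup (tabulate g) (π Perm.⟨$⟩ʳ (cf Perm.⟨$⟩ʳ i))
    ≡⟨ onIndices-lookup (≡.setoid A) (↭⇒↭ₛ f↭g) (cf Perm.⟨$⟩ʳ i) ⟨
  lookup (tabulate f) (cf Perm.⟨$⟩ʳ i)
    ≡⟨ lookup-tabulate f i ⟩
  f i
    ∎
  where
  open ≡-Reasoning
  cf = Perm.cast-id (sym (length-tabulate f))
  cg = Perm.cast-id (sym (length-tabulate g))
  π = onIndices (↭⇒↭ₛ f↭g)

Unique⇒length≤ : ∀ {n} {L : List (Fin n)} → Unique L → length L ℕ.≤ n
Unique⇒length≤ uniq = Fin.injective⇒≤ (lookup-injective uniq)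
  where
  lookup-injective : ∀ {A : Set} {xs : List A} → Unique xs → ∀ {i j} → lookup xs i ≡ lookup xs j → i ≡ j
  lookup-injective (_  ∷ _) {Fin.zero}  {Fin.zero}  _  = refl
  lookup-injective (x∉ ∷ _) {Fin.zero}  {Fin.suc j} eq = contradiction eq (All.lookup x∉ (∈-lookup j))
  lookup-injective (x∉ ∷ _) {Fin.suc i} {Fin.zero}  eq = contradiction (sym eq) (All.lookup x∉ (∈-lookup i))
  lookup-injective (_  ∷ u) {Fin.suc i} {Fin.suc j} eq = cong Fin.suc (lookup-injective u eq)

-- Growing the tree from a star, and the lower bound.

-- The distances from the m-th vertex of the broom with Δ = D + 1 to the vertices 0, …, m - 1 are
-- 1, …, broomSpine D m once each and broomSpine D m + 1 with multiplicity broomLeaves D m.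
broomLeaves broomSpine : ℕ → ℕ → ℕ
broomLeaves D m = ℕ.pred m ⊓ D
broomSpine  D m = m ∸ broomLeaves D m

0<broomSpine : ∀ D {m} → 0 ℕ.< m → 0 ℕ.< broomSpine D m
0<broomSpine D {suc k} _ = ℕ.m<n⇒0<n∸m (s≤s (ℕ.m⊓n≤m k D))

broomLevels : ℕ → ℕ → List ℕ
broomLevels D m = profile 1 (broomSpine D m) (broomLeaves D m)

-- The value put between the two indices: an upper bound for the broom and a lower bound for the
-- tree.
broomTotal : ℕ → ℕ → ℚ
broomTotal D zero    = 0ℚ
broomTotal D (suc m) = reciprocals (broomLevels D m) + broomTotal D m

-- A listing, latest vertex first, of a connected set of vertices grown from w, in which the first
-- D + 1 vertices after w are neighbours of w.
data Growth {n : ℕ} (G : Graph n) (D : ℕ) (w : Fin n) : List (Fin n) → Set where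
  root : Growth G D w [ w ]
  grow : ∀ {u v L} → u ∈ L → v ∉ L → Adj G u v → (length L ℕ.≤ suc D → u ≡ w) →
         Growth G D w L → Growth G D w (v ∷ L)

module _ {n : ℕ} {G : Graph n} {D : ℕ} {w : Fin n} where

  Growth⇒Unique : ∀ {L} → Growth G D w L → Unique L
  Growth⇒Unique root               = [] ∷ []
  Growth⇒Unique (grow _ v∉L _ _ g) = All.¬Any⇒All¬ _ v∉L ∷ Growth⇒Unique g

  Growth⇒root∈ : ∀ {L} → Growth G D w L → w ∈ L
  Growth⇒root∈ root             = here refl
  Growth⇒root∈ (grow _ _ _ _ g) = there (Growth⇒root∈ g)

  module _ {δ : Fin n → ℕ} (lip : ∀ {x y} → Adj G x y → δ x ℕ.≤ suc (δ y) × δ y ℕ.≤ suc (δ x)) where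

    -- If an endpoint is the newest vertex `v`, either its level is `t`, or its earlier neighbour
    -- `u`, whose level differs by at most 1, can replace it as endpoint.
    intermediate-value : ∀ {L a b t} → Growth G D w L → a ∈ L → b ∈ L → δ a ℕ.≤ t → t ℕ.≤ δ b → t ∈ map δ L
    intermediate-value root (here refl) (here refl) a≤t t≤b = here (ℕ.≤-antisym t≤b a≤t)
    intermediate-value (grow _ _ _ _ g) (here refl) (here refl) a≤t t≤b = here (ℕ.≤-antisym t≤b a≤t)
    intermediate-value (grow _ _ _ _ g) (there a∈) (there b∈) a≤t t≤b = there (intermediate-value g a∈ b∈ a≤t t≤b)
    intermediate-value {t = t} (grow {v = v} u∈ _ uv _ g) (here refl) (there b∈) a≤t t≤b with δ v ℕ.≟ t
    ... | yes refl = here refl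
    ... | no  v≢t  = there (intermediate-value g u∈ b∈ (ℕ.≤-trans (proj₁ (lip uv)) (ℕ.≤∧≢⇒< a≤t v≢t)) t≤b)
    intermediate-value {t = t} (grow {v = v} u∈ _ uv _ g) (there a∈) (here refl) a≤t t≤b with t ℕ.≟ δ v
    ... | yes refl = here refl
    ... | no  t≢v  = there (intermediate-value g a∈ u∈ a≤t (ℕ.s≤s⁻¹ (ℕ.≤-trans (ℕ.≤∧≢⇒< t≤b t≢v) (proj₂ (lip uv)))))

    -- The first `D + 2` listed vertices are `w` and neighbours of `w`.
    star-range : ∀ {L y} → Growth G D w L → length L ℕ.≤ suc (suc D) → y ∈ L → δ w ℕ.≤ suc (δ y) × δ y ℕ.≤ suc (δ w)
    star-range root _ (here refl) = ℕ.n≤1+n _ , ℕ.n≤1+n _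
    star-range (grow _ _ uv u≡w g) (s≤s len) (here refl) with refl ← u≡w len = lip uv
    star-range (grow _ _ _ _ g) len (there y∈) = star-range g (ℕ.≤-trans (ℕ.n≤1+n _) len) y∈

    -- Two vertices of the initial star differ by at most 2, by comparison with `w`; each of the `k`
    -- vertices added later hangs on an earlier one and widens the range by at most 1.
    growth-range : ∀ {L a b} k → Growth G D w L → length L ≡ k ℕ.+ suc (suc D) → a ∈ L → b ∈ L →
                   δ b ℕ.≤ suc (suc k) ℕ.+ δ a
    growth-range zero g len a∈ b∈ =
      ℕ.≤-trans (proj₂ (star-range g (ℕ.≤-reflexive len) b∈)) (s≤s (proj₁ (star-range g (ℕ.≤-reflexive len) a∈)))
    growth-range (suc k) root len a∈ b∈ = contradiction (≡.trans (ℕ.suc-injective len) (ℕ.+-suc k (suc D))) λ ()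
    growth-range (suc k) (grow _ _ _ _ g) len (here refl) (here refl) = ℕ.m≤n+m _ (suc (suc (suc k)))
    growth-range (suc k) (grow _ _ _ _ g) len (there a∈) (there b∈) =
      ℕ.≤-trans (growth-range k g (ℕ.suc-injective len) a∈ b∈) (ℕ.n≤1+n _)
    growth-range {a = v} (suc k) (grow {u} u∈ _ uv _ g) len (here refl) (there b∈) =
      ℕ.≤-trans (growth-range k g (ℕ.suc-injective len) u∈ b∈)
        (subst (suc (suc k) ℕ.+ δ u ℕ.≤_) (ℕ.+-suc (suc (suc k)) (δ v)) (ℕ.+-monoʳ-≤ (suc (suc k)) (proj₁ (lip uv))))
    growth-range (suc k) (grow u∈ _ uv _ g) len (there a∈) (here refl) =
      ℕ.≤-trans (proj₂ (lip uv)) (s≤s (growth-range k g (ℕ.suc-injective len) a∈ u∈))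

    -- The neighbour `u` of `v` has level at most 1. In the star phase `u` is `w`, so no level
    -- exceeds 2; afterwards `growth-range` is measured from `u`.
    growth-levels-≤ : ∀ {u v L y} → Growth G D w L → u ∈ L → Adj G u v → (length L ℕ.≤ suc D → u ≡ w) → δ v ≡ 0 →
      y ∈ L → δ y ℕ.≤ broomSpine D (length L) ℕ.+ 1
    growth-levels-≤ {u} {v} {L} {y} g u∈ uv u≡w δv≡0 y∈ with length L ℕ.≤? suc D
    ... | yes short with refl ← u≡w short =
      ℕ.≤-trans (proj₂ (star-range g (ℕ.m≤n⇒m≤1+n short) y∈))
        (subst (suc (δ u) ℕ.≤_) (ℕ.+-comm 1 _) (s≤s (ℕ.≤-trans δu≤1 spine≥1)))
      where
      δu≤1 : δ u ℕ.≤ 1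
      δu≤1 = subst (λ d → δ u ℕ.≤ suc d) δv≡0 (proj₁ (lip uv))
      spine≥1 : 1 ℕ.≤ broomSpine D (length L)
      spine≥1 = 0<broomSpine D (∈-length u∈)
    ... | no long = begin
        δ y                            ≤⟨ growth-range k g len u∈ y∈ ⟩
        suc (suc k) ℕ.+ δ u            ≤⟨ ℕ.+-monoʳ-≤ (suc (suc k)) (subst (λ d → δ u ℕ.≤ suc d) δv≡0 (proj₁ (lip uv))) ⟩
        suc (suc k) ℕ.+ 1              ≡⟨ cong (ℕ._+ 1) spine ⟨
        broomSpine D (length L) ℕ.+ 1  ∎
      where
      open ℕ.≤-Reasoning
      k = length L ∸ suc (suc D)
      len : length L ≡ k ℕ.+ suc (suc D)
      len = sym (ℕ.m∸n+n≡m (ℕ.≰⇒> long))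
      leaves : broomLeaves D (length L) ≡ D
      leaves = ℕ.m≥n⇒m⊓n≡n (ℕ.≤-trans (ℕ.n≤1+n D) (ℕ.<⇒≤pred (ℕ.≰⇒> long)))
      spine : broomSpine D (length L) ≡ suc (suc k)
      spine = ≡.trans (cong₂ _∸_ (≡.trans len (≡.trans (ℕ.+-suc k (suc D)) (cong suc (ℕ.+-suc k D)))) leaves)
                      (ℕ.m+n∸n≡m (suc (suc k)) D)

  module _ (simple : IsSimple G) where

    -- The distances from the newest vertex meet the hypotheses of `reciprocals-profile`: gaps are
    -- excluded by `intermediate-value` starting at `u`, which is at distance at most 1, and the
    -- range is that of `growth-levels-≤`.
    growth-stage : ∀ {v L} → Growth G D w (v ∷ L) → 1 ℕ.≤ length L →
      reciprocals (broomLevels D (length L)) ≤ Σ[ L ] (recipDist G v) ×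
      (Σ[ L ] (recipDist G v) ≡ reciprocals (broomLevels D (length L)) → map (dist G v) L ↭ broomLevels D (length L))
    growth-stage {v} {L} (grow {u} u∈ v∉ uv u≡w g) _ =
      subst (λ s → reciprocals (broomLevels D (length L)) ≤ s ×
                  (s ≡ reciprocals (broomLevels D (length L)) → map (dist G v) L ↭ broomLevels D (length L)))
        (cong sumℚ (sym (map-∘ L)))
        (reciprocals-profile 1 (broomSpine D (length L)) (broomLeaves D (length L)) (map (dist G v) L)
           ℕ.≤-refl length≡ gapFree positive bounded)
      where
      length≡ : length (map (dist G v) L) ≡ broomSpine D (length L) ℕ.+ broomLeaves D (length L)
      length≡ = ≡.trans (length-map (dist G v) L)
        (sym (ℕ.m∸n+n≡m (ℕ.≤-trans (ℕ.m⊓n≤m (ℕ.pred (length L)) D) ℕ.pred[n]≤n)))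
      gapFree : GapFree 1 (map (dist G v) L)
      gapFree d∈ 1≤s s≤d with ∈-map⁻ (dist G v) d∈
      ... | y , y∈ , refl = intermediate-value (dist-lipschitz simple v) g u∈ y∈
        (ℕ.≤-trans (subst (λ d → dist G v u ℕ.≤ suc d) (dist-refl v) (proj₁ (dist-lipschitz simple v uv))) 1≤s) s≤d
      positive : All (1 ℕ.≤_) (map (dist G v) L)
      positive = All.map⁺ (All.tabulate λ y∈ → 0<dist {G = G} λ { refl → v∉ y∈ })
      bounded : All (ℕ._≤ broomSpine D (length L) ℕ.+ 1) (map (dist G v) L)
      bounded = All.map⁺ (All.tabulate (growth-levels-≤ (dist-lipschitz simple v) g u∈ uv u≡w (dist-refl v)))
    growth-stage root ()

    broomTotal≤pairSum : ∀ {L} → Growth G D w L → broomTotal D (length L) ≤ pairSum (recipDist G) L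
    broomTotal≤pairSum root = ℚ.≤-refl
    broomTotal≤pairSum g@(grow {L = x ∷ L} _ _ _ _ g′) =
      ℚ.+-mono-≤ (proj₁ (growth-stage g (s≤s z≤n))) (broomTotal≤pairSum g′)

  growth-star : ∀ ns → Unique ns → w ∉ ns → All (Adj G w) ns → Growth G D w (ns ++ [ w ])
  growth-star []       _           _    _          = root
  growth-star (v ∷ ns) u@(_ ∷ uns) w∉ (wv ∷ wns) =
    grow (∈-++⁺ʳ ns (here refl)) v∉ wv (λ _ → refl) (growth-star ns uns (w∉ ∘ there) wns)
    where
    v∉ : v ∉ ns ++ [ w ]
    v∉ v∈ with ∈-++⁻ ns v∈
    ... | inj₁ v∈ns        = Unique[x∷xs]⇒x∉xs u v∈ns
    ... | inj₂ (here refl) = w∉ (here refl)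

  -- The edge found is the first one by which the walk leaves `L`.
  crossing : ∀ {L : List (Fin n)} {a x} → a ∈ L → x ∉ L → Walk G a x → ∃ λ u → ∃ λ v → u ∈ L × v ∉ L × Adj G u v
  crossing a∈ x∉ (here _) = contradiction a∈ x∉
  crossing {L} a∈ x∉ (step {y = y} ay p) with DecMembership._∈?_ Fin._≟_ y L
  ... | yes y∈ = crossing y∈ x∉ p
  ... | no  y∉ = _ , y , a∈ , y∉ , ay

  growth-full : Connected G → ∀ fuel {L} → n ℕ.≤ fuel ℕ.+ length L → suc (suc D) ℕ.≤ length L → Growth G D w L →
                ∃ λ L′ → Growth G D w L′ × (∀ x → x ∈ L′) × suc (suc D) ℕ.≤ length L′
  growth-full conn fuel {L} n≤ long g with Fin.any? (λ x → ¬? (DecMembership._∈?_ Fin._≟_ x L))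
  ... | no all∈ = L , g , (λ x → decidable-stable (DecMembership._∈?_ Fin._≟_ x L) λ x∉ → all∈ (x , x∉)) , long
  ... | yes (x , x∉) with crossing (Growth⇒root∈ g) x∉ (conn w x)
  -- The star is already complete, so the condition on early vertices is vacuous.
  ...   | u , v , u∈ , v∉ , uv with fuel | grow u∈ v∉ uv (λ short → contradiction long (ℕ.≤⇒≯ short)) g
  -- Without fuel the extended list would hold more than `n` distinct vertices.
  ...     | zero     | g′ = contradiction (Unique⇒length≤ (Growth⇒Unique g′)) (ℕ.<⇒≱ (s≤s n≤))
  ...     | suc fuel | g′ = growth-full conn fuel (subst (n ℕ.≤_) (sym (ℕ.+-suc fuel (length L))) n≤) (ℕ.m≤n⇒m≤1+n long) g′

degree≡length : ∀ {n} (G : Graph n) x → degree G x ≡ length (filter (λ y → G x y Bool.≟ true) (allFin n))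
degree≡length {n} G x = count (allFin n)
  where
  count : ∀ ys → sum (map (λ y → if G x y then 1 else 0) ys) ≡ length (filter (λ y → G x y Bool.≟ true) ys)
  count []       = refl
  count (y ∷ ys) with G x y
  ... | true  = cong suc (count ys)
  ... | false = count ys

full-growth : ∀ {n} {G : Graph n} {D w} → IsSimple G → Connected G → degree G w ≡ suc D →
              ∃ λ L → Growth G D w L × (∀ x → x ∈ L) × suc (suc D) ℕ.≤ length L
full-growth {n} {G} {D} {w} simple conn deg =
  growth-full conn n (ℕ.m≤m+n n _) (ℕ.≤-reflexive (sym len)) (growth-star ns uniq w∉ adj)
  where
  ns = filter (λ y → G w y Bool.≟ true) (allFin n)
  uniq : Unique ns
  uniq = Unique-filter⁺ (λ y → G w y Bool.≟ true) (allFin⁺ n)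
  adj : All (Adj G w) ns
  adj = All.tabulate λ y∈ → proj₂ (∈-filter⁻ (λ y → G w y Bool.≟ true) {xs = allFin n} y∈)
  w∉ : w ∉ ns
  w∉ w∈ = contradiction (≡.trans (sym (All.lookup adj w∈)) (IsSimple.irreflexive simple w)) λ ()
  len : length (ns ++ [ w ]) ≡ suc (suc D)
  len = ≡.trans (length-++ ns) (≡.trans (ℕ.+-comm (length ns) 1) (cong suc (≡.trans (sym (degree≡length G w)) deg)))

-- The edges of the broom.

-- Each edge is oriented from the smaller index to the larger. The spokes end at `1, …, D + 1`, and
-- the handle continues from the spoke `D + 1`.
data BroomEdge (D : ℕ) : ℕ → ℕ → Set where
  spoke : ∀ {x} → x ℕ.≤ D → BroomEdge D 0 (suc x)
  path  : ∀ {i} → D ℕ.≤ i → BroomEdge D (suc i) (suc (suc i))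

broomEdge⇒BroomEdge : ∀ D a b → T (broomEdge (suc D) a b) → BroomEdge D a b
broomEdge⇒BroomEdge D zero    (suc x) e = spoke (ℕ.s≤s⁻¹ (ℕ.≤ᵇ⇒≤ (suc x) (suc D) (left e)))
  where
  -- At index 0 the handle clause of `broomEdge` reduces to `false`.
  left : ∀ {p} → T (p ∨ false) → T p
  left {true} _ = _
broomEdge⇒BroomEdge D (suc i) b e with Equivalence.to (T-∧ {suc D ℕ.≤ᵇ suc i}) e
... | D≤i , b≡ with refl ← ℕ.≡ᵇ⇒≡ b (suc (suc i)) b≡ = path (ℕ.s≤s⁻¹ (ℕ.≤ᵇ⇒≤ (suc D) (suc i) D≤i))

BroomEdge⇒broomEdge : ∀ {D a b} → BroomEdge D a b → T (broomEdge (suc D) a b)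
BroomEdge⇒broomEdge (spoke x≤D) = Equivalence.from T-∨ (inj₁ (ℕ.≤⇒≤ᵇ (s≤s x≤D)))
BroomEdge⇒broomEdge {D} (path {i} D≤i) =
  Equivalence.from (T-∧ {suc D ℕ.≤ᵇ suc i}) (ℕ.≤⇒≤ᵇ (s≤s D≤i) , ℕ.≡⇒≡ᵇ i i refl)

broom-adj : ∀ {n D} {x y : Fin n} → Adj (broom n (suc D)) x y ⇔
            (BroomEdge D (toℕ x) (toℕ y) ⊎ BroomEdge D (toℕ y) (toℕ x))
broom-adj {D = D} {x} {y} = mk⇔
  (λ xy → Sum.map (broomEdge⇒BroomEdge D _ _) (broomEdge⇒BroomEdge D _ _)
    (Equivalence.to (T-∨ {broomEdge (suc D) (toℕ x) (toℕ y)}) (Equivalence.from T-≡ xy)))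
  (λ e → Equivalence.to T-≡ (Equivalence.from (T-∨ {broomEdge (suc D) (toℕ x) (toℕ y)})
    (Sum.map BroomEdge⇒broomEdge BroomEdge⇒broomEdge e)))

broom-simple : ∀ n D → IsSimple (broom n (suc D))
broom-simple n D = record
  { symmetric   = λ x y → ∨-comm (broomEdge (suc D) (toℕ x) (toℕ y)) _
  ; irreflexive = irrefl
  }
  where
  no-loop : ∀ {a} → ¬ BroomEdge D a a
  no-loop ()
  irrefl : ∀ x → broom n (suc D) x x ≡ false
  irrefl x with broom n (suc D) x x in eq
  ... | false = refl
  ... | true  = contradiction (Sum.reduce (Equivalence.to (broom-adj {x = x} {x}) eq)) no-loop

-- Levels in the broom.

-- Distance of x from the vertex j + r + 1 in a broom with r + 1 spokes: j + 1 is the distance of the centre.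
broomLevel : ℕ → ℕ → ℕ → ℕ
broomLevel j r zero    = suc j
broomLevel j r (suc x) = if x <ᵇ r then suc (suc j) else (j ℕ.+ r) ∸ x

broomLevel-leaf : ∀ j {r x} → x ℕ.< r → broomLevel j r (suc x) ≡ suc (suc j)
broomLevel-leaf j {r} {x} x<r with x <ᵇ r | ℕ.<⇒<ᵇ x<r
... | true | _ = refl

broomLevel-path : ∀ j {r x} → r ℕ.≤ x → broomLevel j r (suc x) ≡ (j ℕ.+ r) ∸ x
broomLevel-path j {r} {x} r≤x with x <ᵇ r | ℕ.<ᵇ⇒< x r
... | true  | x<r = contradiction (x<r _) (ℕ.≤⇒≯ r≤x)
... | false | _   = refl

module _ {A : Set} where

  applyUpTo-cong : ∀ {f g : ℕ → A} n → (∀ {i} → i ℕ.< n → f i ≡ g i) → applyUpTo f n ≡ applyUpTo g n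
  applyUpTo-cong zero    eq = refl
  applyUpTo-cong (suc n) eq = cong₂ _∷_ (eq (s≤s z≤n)) (applyUpTo-cong n (eq ∘ s≤s))

  applyUpTo-const : ∀ (c : A) n → applyUpTo (λ _ → c) n ≡ replicate n c
  applyUpTo-const c zero    = refl
  applyUpTo-const c (suc n) = cong (c ∷_) (applyUpTo-const c n)

  applyUpTo-+ : ∀ (f : ℕ → A) m n → applyUpTo f (m ℕ.+ n) ≡ applyUpTo f m ++ applyUpTo (f ∘ (m ℕ.+_)) n
  applyUpTo-+ f zero    n = refl
  applyUpTo-+ f (suc m) n = cong (f 0 ∷_) (applyUpTo-+ (f ∘ suc) m n)

  tabulate-toℕ : ∀ (f : ℕ → A) n → tabulate {n = n} (f ∘ toℕ) ≡ applyUpTo f n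
  tabulate-toℕ f zero    = refl
  tabulate-toℕ f (suc n) = cong (f 0 ∷_) (tabulate-toℕ (f ∘ suc) n)

applyUpTo-∸ : ∀ j → applyUpTo (j ∸_) j ≡ applyDownFrom suc j
applyUpTo-∸ zero    = refl
applyUpTo-∸ (suc j) = cong (suc j ∷_) (applyUpTo-∸ j)

-- Stated for every `f` that agrees with `i + t`, so that the recursion can pass to `f ∘ suc`.
profile-↭ : ∀ t c r (f : ℕ → ℕ) → (∀ i → f i ≡ i ℕ.+ t) →
            applyDownFrom f c ++ replicate r (f c) ↭ profile t c r
profile-↭ t zero    r f eq = ↭-reflexive (cong (replicate r) (eq 0))
profile-↭ t (suc c) r f eq = begin
  applyDownFrom f (suc c) ++ rs                ≡⟨ cong (_++ rs) (applyDownFrom-∷ʳ f c) ⟨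
  (applyDownFrom (f ∘ suc) c ∷ʳ f 0) ++ rs     ↭⟨ ++⁺ʳ rs (∷↭∷ʳ (f 0) (applyDownFrom (f ∘ suc) c)) ⟨
  f 0 ∷ applyDownFrom (f ∘ suc) c ++ rs        ≡⟨ cong (_∷ applyDownFrom (f ∘ suc) c ++ rs) (eq 0) ⟩
  t ∷ applyDownFrom (f ∘ suc) c ++ rs
    ↭⟨ prep t (profile-↭ (suc t) c r (f ∘ suc) (λ i → ≡.trans (eq (suc i)) (sym (ℕ.+-suc i t)))) ⟩
  t ∷ profile (suc t) c r                      ∎
  where
  open PermutationReasoning
  rs = replicate r (f (suc c))

-- In index order the levels are `j + 1` at the centre, `j + 2` at the `r` leaves, and `j, …, 1`
-- along the handle. Moving the leaves to the end leaves one descending run.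
map-broomLevel-↭ : ∀ j r → map (broomLevel j r) (upTo (suc (r ℕ.+ j))) ↭ profile 1 (suc j) r
map-broomLevel-↭ j r = begin
  map (broomLevel j r) (upTo (suc (r ℕ.+ j)))
    ≡⟨ cong (suc j ∷_) (map-applyUpTo suc (broomLevel j r) (r ℕ.+ j)) ⟩
  suc j ∷ applyUpTo (broomLevel j r ∘ suc) (r ℕ.+ j)
    ≡⟨ cong (suc j ∷_) (applyUpTo-+ (broomLevel j r ∘ suc) r j) ⟩
  suc j ∷ applyUpTo (broomLevel j r ∘ suc) r ++ applyUpTo (broomLevel j r ∘ suc ∘ (r ℕ.+_)) j
    ≡⟨ cong₂ (λ xs ys → suc j ∷ xs ++ ys)
         (≡.trans (applyUpTo-cong r (broomLevel-leaf j)) (applyUpTo-const _ r))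
         (≡.trans (applyUpTo-cong j λ {i} _ → ≡.trans (broomLevel-path j (ℕ.m≤m+n r i)) (cancel i)) (applyUpTo-∸ j)) ⟩
  suc j ∷ replicate r (suc (suc j)) ++ applyDownFrom suc j
    ↭⟨ prep (suc j) (++-comm (replicate r (suc (suc j))) (applyDownFrom suc j)) ⟩
  applyDownFrom suc (suc j) ++ replicate r (suc (suc j))
    ↭⟨ profile-↭ 1 (suc j) r suc (λ i → ℕ.+-comm 1 i) ⟩
  profile 1 (suc j) r
    ∎
  where
  open PermutationReasoning
  cancel : ∀ i → (j ℕ.+ r) ∸ (r ℕ.+ i) ≡ j ∸ i
  cancel i = ≡.trans (cong (_∸ (r ℕ.+ i)) (ℕ.+-comm j r)) (ℕ.[m+n]∸[m+o]≡n∸o r j i)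

-- The level of x relative to the vertex k + 1 of the broom with Δ = D + 1.
level : ℕ → ℕ → ℕ → ℕ
level D k = broomLevel (k ∸ (k ⊓ D)) (k ⊓ D)

module _ (D k : ℕ) where

  private
    r = k ⊓ D
    j = k ∸ r

    r≤k : r ℕ.≤ k
    r≤k = ℕ.m⊓n≤m k D

    j+r≡k : j ℕ.+ r ≡ k
    j+r≡k = ℕ.m∸n+n≡m r≤k

  map-level-↭ : map (level D k) (upTo (suc k)) ↭ broomLevels D (suc k)
  map-level-↭ = subst (λ l → map (level D k) (upTo (suc l)) ↭ broomLevels D (suc k)) (ℕ.m+[n∸m]≡n r≤k)
    (subst (λ c → map (level D k) (upTo (suc (r ℕ.+ j))) ↭ profile 1 c r) (sym (ℕ.+-∸-assoc 1 r≤k)) (map-broomLevel-↭ j r))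

  level-self : level D k (suc k) ≡ 0
  level-self = ≡.trans (broomLevel-path j r≤k) (ℕ.m≤n⇒m∸n≡0 (ℕ.≤-reflexive j+r≡k))

  -- The upper bound keeps the level at most `n` whenever the vertex `k + 1` exists, as `dist-≥`
  -- requires.
  level-bounds : ∀ {x} → x ℕ.≤ k → 1 ℕ.≤ level D k x × level D k x ℕ.≤ suc (suc k)
  level-bounds {zero} _ = s≤s z≤n , s≤s (ℕ.m≤n⇒m≤1+n (ℕ.m∸n≤m k r))
  level-bounds {suc x} x<k with x ℕ.<? r
  ... | yes x<r = subst (λ l → 1 ℕ.≤ l × l ℕ.≤ suc (suc k)) (sym (broomLevel-leaf j x<r)) (s≤s z≤n , s≤s (s≤s (ℕ.m∸n≤m k r)))
  ... | no  x≮r = subst (λ l → 1 ℕ.≤ l × l ℕ.≤ suc (suc k)) (sym (≡.trans (broomLevel-path j (ℕ.≮⇒≥ x≮r)) (cong (_∸ x) j+r≡k)))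
                    (ℕ.m<n⇒0<n∸m x<k , ℕ.m≤n⇒m≤1+n (ℕ.m≤n⇒m≤1+n (ℕ.m∸n≤m k x)))

  -- Past the vertex `k + 1` truncated subtraction yields level 0; this is not the distance there,
  -- but the change along an edge is still at most 1.
  level-edge : ∀ {a b} → BroomEdge D a b → level D k a ℕ.≤ suc (level D k b) × level D k b ℕ.≤ suc (level D k a)
  level-edge (spoke {x} x≤D) with x ℕ.<? r
  ... | yes x<r = subst (λ l → suc j ℕ.≤ suc l × l ℕ.≤ suc (suc j)) (sym (broomLevel-leaf j x<r))
                    (s≤s (ℕ.m≤n⇒m≤1+n (ℕ.n≤1+n j)) , ℕ.≤-refl)
  ... | no  x≮r = subst (λ l → suc j ℕ.≤ suc l × l ℕ.≤ suc (suc j)) (sym (broomLevel-path j (ℕ.≮⇒≥ x≮r)))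
                    (s≤s lower , ℕ.m≤n⇒m≤1+n (ℕ.m≤n⇒m≤1+n upper))
    where
    upper : (j ℕ.+ r) ∸ x ℕ.≤ j
    upper = subst ((j ℕ.+ r) ∸ x ℕ.≤_) (ℕ.m+n∸n≡m j r) (ℕ.∸-monoʳ-≤ (j ℕ.+ r) (ℕ.≮⇒≥ x≮r))
    -- Either `k ≤ D` and `j = 0`, or `r = D` and the only such spoke is the first vertex of the
    -- handle.
    lower : j ℕ.≤ (j ℕ.+ r) ∸ x
    lower with ℕ.≤-total k D
    ... | inj₁ k≤D = subst (ℕ._≤ (j ℕ.+ r) ∸ x) (sym (ℕ.m≤n⇒m∸n≡0 (ℕ.≤-reflexive (sym (ℕ.m≤n⇒m⊓n≡m k≤D))))) z≤n
    ... | inj₂ D≤k = subst (ℕ._≤ (j ℕ.+ r) ∸ x) (ℕ.m+n∸n≡m j r)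
                       (ℕ.∸-monoʳ-≤ (j ℕ.+ r) (subst (x ℕ.≤_) (sym (ℕ.m≥n⇒m⊓n≡n D≤k)) x≤D))
  level-edge (path {i} D≤i) = ≡.subst₂ (λ l l′ → l ℕ.≤ suc l′ × l′ ℕ.≤ suc l)
    (sym (broomLevel-path j r≤i)) (sym (broomLevel-path j (ℕ.m≤n⇒m≤1+n r≤i)))
    (∸-suc-≤ (j ℕ.+ r) i , ℕ.m≤n⇒m≤1+n (ℕ.∸-monoʳ-≤ (j ℕ.+ r) (ℕ.n≤1+n i)))
    where
    r≤i : r ℕ.≤ i
    r≤i = ℕ.≤-trans (ℕ.m⊓n≤n k D) D≤i
    ∸-suc-≤ : ∀ m i → m ∸ i ℕ.≤ suc (m ∸ suc i)
    ∸-suc-≤ zero    i       = subst (ℕ._≤ 1) (sym (ℕ.0∸n≡0 i)) z≤n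
    ∸-suc-≤ (suc m) zero    = ℕ.≤-refl
    ∸-suc-≤ (suc m) (suc i) = ∸-suc-≤ m i

-- The upper bound for the broom.

-- By `dist-≥` the levels bound the distances from below, and the reciprocals of the levels add up,
-- row by row, to `broomTotal`.
harary-broom-≤ : ∀ n D → harary (broom n (suc D)) ≤ broomTotal D n
harary-broom-≤ n D = begin
  harary B                                                ≡⟨ harary≡pairSum B ⟩
  pairSum (recipDist B) (allFin n)                        ≤⟨ pairSum-mono-≤ recipDist-≤ (allFin-< n) ⟩
  pairSum (λ x y → s (toℕ x) (toℕ y)) (allFin n)          ≡⟨ pairSum-map toℕ s (allFin n) ⟨
  pairSum s (map toℕ (allFin n))
    ≡⟨ cong (pairSum s) (≡.trans (map-tabulate id toℕ) (tabulate-toℕ id n)) ⟩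
  pairSum s (upTo n)                                      ≡⟨ pairSum-upTo n ⟩
  broomTotal D n                                          ∎
  where
  open ℚ.≤-Reasoning
  B = broom n (suc D)
  s : ℕ → ℕ → ℚ
  -- `level D k` refers to the vertex `k + 1`, hence the predecessor; no vertex precedes `y = 0`.
  s x y = recip (level D (ℕ.pred y) x)

  recipDist-≤ : ∀ {x y : Fin n} → toℕ x ℕ.< toℕ y → recipDist B x y ≤ s (toℕ x) (toℕ y)
  recipDist-≤ {x} {y} x<y with toℕ y in eq
  ... | suc k = recip-antimono-≤ (proj₁ bounds)
    (dist-≥ (level D k ∘ toℕ) (λ {x} {y} → lip {x} {y}) (≡.trans (cong (level D k) eq) (level-self D k))
      (ℕ.≤-trans (proj₂ bounds) (subst (ℕ._< n) eq (Fin.toℕ<n y))))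
    where
    bounds = level-bounds D k (ℕ.s≤s⁻¹ x<y)
    lip : ∀ {x y} → Adj B x y → level D k (toℕ x) ℕ.≤ suc (level D k (toℕ y))
    lip {x} {y} xy with Equivalence.to (broom-adj {x = x} {y}) xy
    ... | inj₁ e = proj₁ (level-edge D k e)
    ... | inj₂ e = proj₂ (level-edge D k e)

  row : ∀ n → Σ[ upTo n ] (λ x → s x n) ≡ reciprocals (broomLevels D n)
  row zero    = refl
  row (suc k) = ≡.trans (cong sumℚ (map-∘ {g = recip} {f = level D k} (upTo (suc k)))) (Σ-↭ recip (map-level-↭ D k))

  pairSum-upTo : ∀ n → pairSum s (upTo n) ≡ broomTotal D n
  pairSum-upTo zero    = refl
  pairSum-upTo (suc n) = ≡.trans (cong (pairSum s) (sym (upTo-∷ʳ n)))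
    (≡.trans (pairSum-∷ʳ s (upTo n) n) (cong₂ _+_ (row n) (pairSum-upTo n)))

-- Broom edges as pairs on consecutive levels.

module _ {j D : ℕ} where

  -- The graph of `broomLevel j D` on the indices up to `j + D + 1`, split by the parts of the
  -- broom; there the subtraction is exact, recorded as `i + l ≡ j`.
  data Position : ℕ → ℕ → Set where
    centre : Position 0 (suc j)
    leaf   : ∀ {x} → x ℕ.< D → Position (suc x) (suc (suc j))
    path   : ∀ i {l} → i ℕ.+ l ≡ j → Position (suc (i ℕ.+ D)) l

  position : ∀ {x} → x ℕ.≤ suc (j ℕ.+ D) → Position x (broomLevel j D x)
  position {zero}  _ = centre
  position {suc x} (s≤s x≤) with x ℕ.<? D
  ... | yes x<D = subst (Position (suc x)) (sym (broomLevel-leaf j x<D)) (leaf x<D)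
  ... | no  x≮D = ≡.subst₂ (λ y → Position (suc y)) i+D≡x (sym (broomLevel-path j (ℕ.≮⇒≥ x≮D))) (path i i+l≡j)
    where
    i = x ∸ D
    i+D≡x : i ℕ.+ D ≡ x
    i+D≡x = ℕ.m∸n+n≡m (ℕ.≮⇒≥ x≮D)
    i+l≡j : i ℕ.+ ((j ℕ.+ D) ∸ x) ≡ j
    i+l≡j = ℕ.+-cancelʳ-≡ D _ j (begin
      (i ℕ.+ ((j ℕ.+ D) ∸ x)) ℕ.+ D   ≡⟨ ℕ.+-assoc i _ D ⟩
      i ℕ.+ (((j ℕ.+ D) ∸ x) ℕ.+ D)   ≡⟨ cong (i ℕ.+_) (ℕ.+-comm _ D) ⟩
      i ℕ.+ (D ℕ.+ ((j ℕ.+ D) ∸ x))   ≡⟨ ℕ.+-assoc i D _ ⟨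
      (i ℕ.+ D) ℕ.+ ((j ℕ.+ D) ∸ x)   ≡⟨ cong (ℕ._+ ((j ℕ.+ D) ∸ x)) i+D≡x ⟩
      x ℕ.+ ((j ℕ.+ D) ∸ x)           ≡⟨ ℕ.m+[n∸m]≡n x≤ ⟩
      j ℕ.+ D                         ∎)
      where open ≡-Reasoning

  level≤ : ∀ {i l} → i ℕ.+ l ≡ j → l ℕ.≤ j
  level≤ {i} {l} eq = subst (l ℕ.≤_) eq (ℕ.m≤n+m l i)

  position-bounds : ∀ {x l} → Position x l → l ℕ.≤ suc (suc j) × l ℕ.≤ suc (j ℕ.+ D)
  position-bounds centre      = ℕ.n≤1+n _ , s≤s (ℕ.m≤m+n j D)
  position-bounds (leaf x<D)  = ℕ.≤-refl ,
    s≤s (ℕ.≤-trans (ℕ.≤-reflexive (ℕ.+-comm 1 j)) (ℕ.+-monoʳ-≤ j (ℕ.≤-trans (s≤s z≤n) x<D)))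
  position-bounds (path i eq) = ℕ.m≤n⇒m≤1+n (ℕ.m≤n⇒m≤1+n (level≤ {i} eq)) ,
    ℕ.m≤n⇒m≤1+n (ℕ.≤-trans (level≤ {i} eq) (ℕ.m≤m+n j D))

  -- Only the level `j + 2` of the leaves is shared: the centre alone has level `j + 1`, and the
  -- handle meets each lower level once.
  position-injective : ∀ {x y l} → Position x l → Position y l → l ℕ.≤ suc j → x ≡ y
  position-injective centre centre _ = refl
  position-injective centre (path i eq) _ = contradiction (level≤ {i} eq) (ℕ.<⇒≱ ℕ.≤-refl)
  position-injective (leaf _) _ l≤ = contradiction l≤ (ℕ.<⇒≱ ℕ.≤-refl)
  position-injective (path i eq) centre _ = contradiction (level≤ {i} eq) (ℕ.<⇒≱ ℕ.≤-refl)
  position-injective (path i eq) (leaf _) l≤ = contradiction l≤ (ℕ.<⇒≱ ℕ.≤-refl)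
  position-injective (path i {l} eq) (path i′ eq′) _ =
    cong (λ i → suc (i ℕ.+ D)) (ℕ.+-cancelʳ-≡ l i i′ (≡.trans eq (sym eq′)))

  -- Together with `broomLevel-edge`, this identifies the edges of the broom with the pairs on
  -- consecutive levels.
  position-adjacent : ∀ {a b l} → Position a (suc l) → Position b l → BroomEdge D a b ⊎ BroomEdge D b a
  position-adjacent centre (path zero _) = inj₁ (spoke ℕ.≤-refl)
  position-adjacent centre (path (suc i) eq) = contradiction (ℕ.≤-reflexive eq) (ℕ.<⇒≱ (s≤s (ℕ.m≤n+m j i)))
  position-adjacent (leaf x<D) centre = inj₂ (spoke (ℕ.<⇒≤ x<D))
  position-adjacent (leaf _) (path i eq) = contradiction (level≤ {i} eq) (ℕ.<⇒≱ ℕ.≤-refl)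
  position-adjacent (path i eq) centre = contradiction (level≤ {i} eq) (ℕ.<⇒≱ (ℕ.n≤1+n _))
  position-adjacent (path i eq) (leaf _) = contradiction (level≤ {i} eq) (ℕ.<⇒≱ (ℕ.m≤n⇒m≤1+n (ℕ.n≤1+n _)))
  position-adjacent (path i {suc l} eq) (path i′ eq′)
    with refl ← ℕ.+-cancelʳ-≡ l i′ (suc i) (≡.trans eq′ (≡.trans (sym eq) (ℕ.+-suc i l))) = inj₁ (path (ℕ.m≤n+m D i))

  broomLevel-edge : ∀ {a b} → BroomEdge D a b → b ℕ.≤ suc (j ℕ.+ D) →
    broomLevel j D a ≡ suc (broomLevel j D b) ⊎ broomLevel j D b ≡ suc (broomLevel j D a)
  broomLevel-edge (spoke x≤D) _ with ℕ.m≤n⇒m<n∨m≡n x≤D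
  ... | inj₁ x<D  = inj₂ (broomLevel-leaf j x<D)
  ... | inj₂ refl = inj₁ (cong suc (sym (≡.trans (broomLevel-path j {D} ℕ.≤-refl) (ℕ.m+n∸n≡m j D))))
  broomLevel-edge (path {i} D≤i) (s≤s i<) = inj₁ (begin
    broomLevel j D (suc i)              ≡⟨ broomLevel-path j D≤i ⟩
    (j ℕ.+ D) ∸ i                       ≡⟨ ℕ.+-∸-assoc 1 i< ⟩
    suc ((j ℕ.+ D) ∸ suc i)             ≡⟨ cong suc (broomLevel-path j (ℕ.m≤n⇒m≤1+n D≤i)) ⟨
    suc (broomLevel j D (suc (suc i)))  ∎)
    where open ≡-Reasoning

-- Reconstructing the tree from its levels.

module _ {n : ℕ} {G : Graph n} (tree : IsTree G) {v : Fin n} {j D : ℕ} (n≡ : n ≡ suc (suc (j ℕ.+ D)))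
         (σ : Fin n ↔ Fin n) (σ-level : ∀ x → broomLevel j D (toℕ (Inverse.to σ x)) ≡ dist G v x) where

  private
    simple = proj₁ tree
    f = Inverse.to σ

    adj-sym : ∀ {x y} → Adj G x y → Adj G y x
    adj-sym {x} {y} = ≡.trans (IsSimple.symmetric simple y x)

    adj-≢ : ∀ {x y} → Adj G x y → x ≢ y
    adj-≢ {x} xy refl = contradiction (≡.trans (sym xy) (IsSimple.irreflexive simple x)) λ ()

    f≤ : ∀ x → toℕ (f x) ℕ.≤ suc (j ℕ.+ D)
    f≤ x = ℕ.s≤s⁻¹ (subst (toℕ (f x) ℕ.<_) n≡ (Fin.toℕ<n (f x)))

    pos : ∀ x → Position {j} {D} (toℕ (f x)) (dist G v x)
    pos x = subst (Position (toℕ (f x))) (σ-level x) (position (f≤ x))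

    dist<n : ∀ x → dist G v x ℕ.< n
    dist<n x = subst (dist G v x ℕ.<_) (sym n≡) (s≤s (proj₂ (position-bounds (pos x))))

    level-unique : ∀ {x y} → dist G v x ≡ dist G v y → dist G v x ℕ.≤ suc j → x ≡ y
    level-unique {x} {y} eq low = ≡.trans (sym (Perm.inverseˡ σ)) (≡.trans (cong (Inverse.from σ)
      (Fin.toℕ-injective (position-injective (pos x) (subst (Position (toℕ (f y))) (sym eq) (pos y)) low))) (Perm.inverseˡ σ))

    -- The predecessor of `y` on a shortest path from `v` shares the level of `x`. This level is at
    -- most `j + 1`, hence a singleton.
    consecutive⇒adj : ∀ {x y} → dist G v y ≡ suc (dist G v x) → Adj G x y
    consecutive⇒adj {x} {y} eq with dist-pred eq (subst (ℕ._< n) eq (dist<n y))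
    ... | z , z≡x , zy = subst (λ z → Adj G z y) (level-unique z≡x z-low) zy
      where
      z-low : dist G v z ℕ.≤ suc j
      z-low = ℕ.s≤s⁻¹ (subst (ℕ._≤ suc (suc j)) (≡.trans eq (cong suc (sym z≡x))) (proj₁ (position-bounds (pos y))))

    -- Two adjacent vertices on the last level would form a triangle with their common parent.
    adj⇒level-≢ : ∀ {x y} → Adj G x y → dist G v x ≢ dist G v y
    adj⇒level-≢ {x} {y} xy eq with dist G v x ℕ.≤? suc j
    ... | yes low = adj-≢ xy (level-unique eq low)
    ... | no high with dist-pred {G = G} {v} {x} {suc j} top (subst (ℕ._< n) top (dist<n x))
      where
      top : dist G v x ≡ suc (suc j)
      top = ℕ.≤-antisym (proj₁ (position-bounds (pos x))) (ℕ.≰⇒> high)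
    ...   | z , z≡ , zx = proj₂ (proj₂ tree) (x , y ∷ z ∷ [] , s≤s (s≤s z≤n) ,
        (adj-≢ xy ∷ adj-≢ (adj-sym zx) ∷ []) ∷ (adj-≢ (adj-sym zy) ∷ []) ∷ [] ∷ [] ,
        cons xy (cons (adj-sym zy) (cons zx (single x))))
      where
      zy : Adj G z y
      zy = consecutive⇒adj (≡.trans (sym eq) (≡.trans
        (ℕ.≤-antisym (proj₁ (position-bounds (pos x))) (ℕ.≰⇒> high)) (cong suc (sym z≡))))

    adj⇒consecutive : ∀ {x y} → Adj G x y → dist G v x ≡ suc (dist G v y) ⊎ dist G v y ≡ suc (dist G v x)
    adj⇒consecutive {x} {y} xy with ℕ.<-cmp (dist G v x) (dist G v y)
    ... | tri< x<y _ _ = inj₂ (ℕ.≤-antisym (proj₂ (dist-lipschitz simple v xy)) x<y)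
    ... | tri≈ _ eq _  = contradiction eq (adj⇒level-≢ xy)
    ... | tri> _ _ y<x = inj₁ (ℕ.≤-antisym (proj₁ (dist-lipschitz simple v xy)) y<x)

    adj⇒broom : ∀ {x y} → Adj G x y → Adj (broom n (suc D)) (f x) (f y)
    adj⇒broom {x} {y} xy = Equivalence.from (broom-adj {x = f x} {f y}) (edge (adj⇒consecutive xy))
      where
      edge : dist G v x ≡ suc (dist G v y) ⊎ dist G v y ≡ suc (dist G v x) →
             BroomEdge D (toℕ (f x)) (toℕ (f y)) ⊎ BroomEdge D (toℕ (f y)) (toℕ (f x))
      edge (inj₁ eq) = position-adjacent (subst (Position _) eq (pos x)) (pos y)
      edge (inj₂ eq) = Sum.swap (position-adjacent (subst (Position _) eq (pos y)) (pos x))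

    levels⇒adj : ∀ {x y} → broomLevel j D (toℕ (f x)) ≡ suc (broomLevel j D (toℕ (f y))) ⊎
                           broomLevel j D (toℕ (f y)) ≡ suc (broomLevel j D (toℕ (f x))) → Adj G x y
    levels⇒adj {x} {y} (inj₁ eq) = adj-sym (consecutive⇒adj (≡.trans (sym (σ-level x)) (≡.trans eq (cong suc (σ-level y)))))
    levels⇒adj {x} {y} (inj₂ eq) = consecutive⇒adj (≡.trans (sym (σ-level y)) (≡.trans eq (cong suc (σ-level x))))

    broom⇒adj : ∀ {x y} → Adj (broom n (suc D)) (f x) (f y) → Adj G x y
    broom⇒adj {x} {y} e with Equivalence.to (broom-adj {x = f x} {f y}) e
    ... | inj₁ xy = levels⇒adj (broomLevel-edge xy (f≤ y))
    ... | inj₂ yx = adj-sym (levels⇒adj (broomLevel-edge yx (f≤ x)))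

  -- In both graphs adjacency means lying on consecutive levels, and `σ` preserves levels.
  levels⇒Isomorphic : Isomorphic G (broom n (suc D))
  levels⇒Isomorphic = σ , λ x y → ⇔→≡ (mk⇔ adj⇒broom broom⇒adj)

-- The maximum degree and the conclusion.

degree≤maxDegree : ∀ {n} (G : Graph n) x → degree G x ℕ.≤ maxDegree G
degree≤maxDegree {n} G x = ≤max (∈-map⁺ (degree G) (∈-allFin x))
  where
  ≤max : ∀ {d ds} → d ∈ ds → d ℕ.≤ foldr _⊔_ 0 ds
  ≤max {ds = e ∷ ds} (here refl) = ℕ.m≤m⊔n e _
  ≤max {ds = e ∷ ds} (there d∈)  = ℕ.≤-trans (≤max d∈) (ℕ.m≤n⊔m e _)

-- A walk between two distinct vertices has an edge, so the maximum is positive; hence it is not the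
-- initial value 0 of the fold but the degree of some vertex.
maxDegree-attained : ∀ {m} (G : Graph (suc (suc m))) → Connected G →
                     ∃ λ w → ∃ λ D → degree G w ≡ suc D × maxDegree G ≡ suc D
maxDegree-attained {m} G conn with positive (conn Fin.zero (Fin.suc Fin.zero)) (λ ())
  where
  positive : ∀ {x y} → Walk G x y → x ≢ y → 0 ℕ.< maxDegree G
  positive (here _) x≢x = contradiction refl x≢x
  positive {x} (step {y = y} xy _) _ = ℕ.≤-trans
    (subst (0 ℕ.<_) (sym (degree≡length G x)) (∈-length (∈-filter⁺ (λ y → G x y Bool.≟ true) (∈-allFin y) xy)))
    (degree≤maxDegree G x)
... | 0<Δ with foldr-selective ℕ.⊔-sel 0 (map (degree G) (allFin (suc (suc m))))
...   | inj₁ Δ≡0 = contradiction (sym Δ≡0) (ℕ.<⇒≢ 0<Δ)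
...   | inj₂ Δ∈ with ∈-map⁻ (degree G) Δ∈
...     | w , _ , Δ≡ = w , ℕ.pred (maxDegree G) ,
  ≡.trans (sym Δ≡) (sym (ℕ.suc-pred (maxDegree G) {{ℕ.>-nonZero 0<Δ}})) ,
  sym (ℕ.suc-pred (maxDegree G) {{ℕ.>-nonZero 0<Δ}})

module _ {k : ℕ} {G : Graph (suc (suc k))} (tree : IsTree G) {D : ℕ} {w : Fin (suc (suc k))}
         (deg : degree G w ≡ suc D) where

  private
    n = suc (suc k)
    simple = proj₁ tree

  -- The stages of a full growth are summed. Equality in the total forces equality at the last
  -- vertex `v`, whose distances then match the levels of the broom.
  harary-bound : broomTotal D n ≤ harary G × (harary G ≡ broomTotal D n → Isomorphic G (broom n (suc D)))
  harary-bound with full-growth simple (proj₁ (proj₂ tree)) deg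
  ... | [] , () , _
  ... | v ∷ L , g , full , long =
    ≡.subst₂ _≤_ (cong (broomTotal D ∘ suc) length≡) (sym harary≡) (broomTotal≤pairSum simple g) , iso
    where
    vL↭ : v ∷ L ↭ allFin n
    vL↭ = unique∧full⇒↭ (Growth⇒Unique g) full

    length≡ : length L ≡ suc k
    length≡ = ℕ.suc-injective (≡.trans (↭-length vL↭) (length-tabulate id))

    harary≡ : harary G ≡ pairSum (recipDist G) (v ∷ L)
    harary≡ = ≡.trans (harary≡pairSum G) (sym (pairSum-↭ (λ x y → cong recip (dist-sym simple x y)) vL↭))

    D≤k : D ℕ.≤ k
    D≤k = ℕ.s≤s⁻¹ (subst (suc D ℕ.≤_) length≡ (ℕ.s≤s⁻¹ long))

    k⊓D≡D : k ⊓ D ≡ D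
    k⊓D≡D = ℕ.m≥n⇒m⊓n≡n D≤k

    0<length : 0 ℕ.< length L
    0<length = subst (0 ℕ.<_) (sym length≡) (s≤s z≤n)

    iso : harary G ≡ broomTotal D n → Isomorphic G (broom n (suc D))
    -- `v` takes the place of the last broom vertex `k + 1`. The listing contains the whole star, so
    -- `D ≤ k` and the minimum in `level` is `D`.
    iso eq = levels⇒Isomorphic tree {v} {k ∸ D} {D} (cong (suc ∘ suc) (sym (ℕ.m∸n+n≡m D≤k)))
               (proj₁ matching)
               (subst (λ r → ∀ x → broomLevel (k ∸ r) r (toℕ (Inverse.to (proj₁ matching) x)) ≡ dist G v x) k⊓D≡D (proj₂ matching))
      where
      stage = growth-stage simple g 0<length

      last-tight : Σ[ L ] (recipDist G v) ≡ reciprocals (broomLevels D (length L))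
      last-tight = proj₁ (+-≤-tight (proj₁ stage) (tail≤ g) (≡.trans (sym harary≡)
        (≡.trans eq (cong (broomTotal D ∘ suc) (sym length≡)))))
        where
        tail≤ : ∀ {v L} → Growth G D w (v ∷ L) → broomTotal D (length L) ≤ pairSum (recipDist G) L
        tail≤ root              = ℚ.≤-refl
        tail≤ (grow _ _ _ _ g′) = broomTotal≤pairSum simple g′

      levels↭ : tabulate (dist G v) ↭ tabulate {n = n} (level D k ∘ toℕ)
      levels↭ = begin
        tabulate (dist G v)                                       ≡⟨ map-tabulate id (dist G v) ⟨
        map (dist G v) (allFin n)                                 ↭⟨ map⁺ (dist G v) vL↭ ⟨
        dist G v v ∷ map (dist G v) L                             ↭⟨ prep _ (proj₂ stage last-tight) ⟩
        dist G v v ∷ broomLevels D (length L)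
          ≡⟨ cong₂ _∷_ (≡.trans (dist-refl v) (sym (level-self D k))) (cong (broomLevels D) length≡) ⟩
        level D k (suc k) ∷ broomLevels D (suc k)                 ↭⟨ prep _ (map-level-↭ D k) ⟨
        level D k (suc k) ∷ map (level D k) (upTo (suc k))        ↭⟨ ∷↭∷ʳ _ _ ⟩
        map (level D k) (upTo (suc k)) ∷ʳ level D k (suc k)       ≡⟨ map-++ (level D k) (upTo (suc k)) _ ⟨
        map (level D k) (upTo (suc k) ∷ʳ suc k)                   ≡⟨ cong (map (level D k)) (upTo-∷ʳ (suc k)) ⟩
        map (level D k) (upTo n)                                  ≡⟨ map-applyUpTo id (level D k) n ⟩
        applyUpTo (level D k) n                                   ≡⟨ tabulate-toℕ (level D k) n ⟨
        tabulate (level D k ∘ toℕ)                                ∎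
        where open PermutationReasoning

      matching : Σ (Fin n ↔ Fin n) λ σ → ∀ x → level D k (toℕ (Inverse.to σ x)) ≡ dist G v x
      matching = tabulate-↭⇒permutation (dist G v) (level D k ∘ toℕ) levels↭

theorem3p10 : (n : ℕ) (T : Graph n) → IsTree T →
    (harary (broom n (maxDegree T)) ≤ harary T)
    × ((harary T ≡ harary (broom n (maxDegree T))) ⇔ Isomorphic T (broom n (maxDegree T)))
theorem3p10 zero T tree = ℚ.≤-refl , mk⇔ (λ _ → Perm.id , λ ()) (λ _ → refl)
theorem3p10 (suc zero) T (simple , _) =
  ℚ.≤-refl , mk⇔ (λ _ → Perm.id , λ { Fin.zero Fin.zero → single-vertex }) (λ _ → refl)
  where
  single-vertex : T Fin.zero Fin.zero ≡ broom 1 (maxDegree T) Fin.zero Fin.zero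
  -- The split only lets `broomEdge` compute; neither graph has a loop.
  single-vertex with maxDegree T
  ... | zero  = IsSimple.irreflexive simple Fin.zero
  ... | suc _ = IsSimple.irreflexive simple Fin.zero
theorem3p10 n@(suc (suc k)) T tree with maxDegree-attained T (proj₁ (proj₂ tree))
... | w , D , deg , Δ≡ rewrite Δ≡ with harary-bound tree deg
...   | bound , tight =
  ℚ.≤-trans (harary-broom-≤ n D) bound ,
  -- If the indices agree, `harary T` is both at most and at least `broomTotal D n`.
  mk⇔ (λ eq → tight (ℚ.≤-antisym (subst (_≤ broomTotal D n) (sym eq) (harary-broom-≤ n D)) bound))
      (harary-iso (broom-simple n D))
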